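{- Let $k\ge 1$ and $n\ge 0$ be integers, and let $B_n$ be the perfect binary tree in which every leaf has height (distance from the root) $n$. If the vertices of $B_n$ are colored uniformly and independently with $k$ colors, the expected number of blocks is $$\mathbb{E}[X_{k}(B_n)] = \frac{k+2(k-1)(2^{n}-1)}{k}.$$
   Context: Given a coloring of the vertices of a finite graph $G$ with $k$ colors, the blocks are the connected components of the subgraph of $G$ formed by all vertices and all edges whose two endpoints have the same color. $X_k(G)$ denotes the number of blocks when each vertex of $G$ receives independently a uniformly random color among $k$ colors. A perfect binary tree is a rooted tree in which every vertex has either $0$ or $2$ children and all leaves are at the same height (the one-vertex tree for height $0$). -}

module Defs where

open import Data.Empty using (⊥-elim)
open import Data.Fin.Base using (Fin; zero; suc; splitAt; join; finToFun)
import Data.Fin.Properties as Fin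
open import Data.Integer.Base using (+_)
open import Data.List.Base using (List; []; _∷_; length; map; tabulate; allFin; deduplicate)
open import Data.List.Membership.Propositional using (_∈_)
open import Data.List.Membership.Propositional.Properties using (∈-map⁺; ∈-allFin)
import Data.List.Relation.Unary.Any as Any
open import Data.List.Relation.Unary.Any using (Any; here; there)
import Data.List.Relation.Unary.Any.Properties as Any
open import Data.List.Relation.Unary.AllPairs using (AllPairs)
import Data.List.Relation.Unary.Unique.DecSetoid.Properties as UniqueDecSetoid
open import Data.Nat.Base using (ℕ; zero; suc; _+_; _^_; NonZero)
open import Data.Nat.ListAction using (sum)
open import Data.Nat.Properties using (m^n≢0; suc-injective)
open import Data.Product.Base using (_×_; _,_)
open import Data.Rational.Base using (ℚ; _/_)
open import Data.Sum.Base using (_⊎_; inj₁; inj₂)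
open import Function.Base using (_∘_)
open import Function.Bundles using (_↔_; Inverse; mk↔ₛ′)
open import Function.Properties.Inverse using (Inverse⇒Injection)
open import Level using (0ℓ)
open import Relation.Binary.Bundles using (DecSetoid)
open import Relation.Binary.Core using (Rel)
open import Relation.Binary.Definitions using (Decidable; DecidableEquality; Symmetric; Irreflexive)
open import Relation.Binary.Construct.Closure.ReflexiveTransitive using (Star; ε; _◅_; _◅◅_; reverse)
open import Relation.Binary.Construct.Closure.Symmetric using (SymClosure; fwd; bwd) renaming (symmetric to symClosure-sym)
open import Relation.Binary.PropositionalEquality using (_≡_; refl; sym; trans; cong; cong₂; subst)
open import Relation.Nullary using (¬_; yes; no)
open import Relation.Nullary.Decidable using (map′; _×-dec_; _⊎-dec_; via-injection)

record FiniteGraph : Set₁ where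
  field
    Vertex     : Set
    order      : ℕ
    enum       : Vertex ↔ Fin order
    Adj        : Rel Vertex 0ℓ
    adj?       : Decidable Adj
    adj-sym    : Symmetric Adj
    adj-irrefl : Irreflexive _≡_ Adj

  index : Vertex → Fin order
  index = Inverse.to enum

  _≟ᵛ_ : DecidableEquality Vertex
  _≟ᵛ_ = via-injection (Inverse⇒Injection enum) Fin._≟_

  vertices : List Vertex
  vertices = map (Inverse.from enum) (allFin order)

  ∈-vertices : ∀ v → v ∈ vertices
  ∈-vertices v = subst (_∈ vertices) (Inverse.strictlyInverseʳ enum v)
                   (∈-map⁺ (Inverse.from enum) (∈-allFin (index v)))

  -- The connected components are the equivalence classes of this relation.
  Connected : Rel Vertex 0ℓ
  Connected = Star Adj

  -- Connectivity is decided by the Floyd–Warshall recursion: Via ps u v holds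
  -- when some walk from u to v has all its intermediate vertices in ps.
  private
    Via : List Vertex → Rel Vertex 0ℓ
    Via []       u v = u ≡ v ⊎ Adj u v
    Via (p ∷ ps) u v = Via ps u v ⊎ (Via ps u p × Via ps p v)

    via? : ∀ ps → Decidable (Via ps)
    via? []       u v = (u ≟ᵛ v) ⊎-dec adj? u v
    via? (p ∷ ps) u v = via? ps u v ⊎-dec (via? ps u p ×-dec via? ps p v)

    via⇒connected : ∀ ps {u v} → Via ps u v → Connected u v
    via⇒connected []       (inj₁ refl)    = ε
    via⇒connected []       (inj₂ a)       = a ◅ ε
    via⇒connected (p ∷ ps) (inj₁ r)       = via⇒connected ps r
    via⇒connected (p ∷ ps) (inj₂ (r , s)) = via⇒connected ps r ◅◅ via⇒connected ps s

    via-base : ∀ ps {u v} → Via [] u v → Via ps u v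
    via-base []       r = r
    via-base (p ∷ ps) r = inj₁ (via-base ps r)

    via-to-head : ∀ {p} ps {u} → Via (p ∷ ps) u p → Via ps u p
    via-to-head ps (inj₁ r)       = r
    via-to-head ps (inj₂ (r , _)) = r

    via-from-head : ∀ {p} ps {v} → Via (p ∷ ps) p v → Via ps p v
    via-from-head ps (inj₁ r)       = r
    via-from-head ps (inj₂ (_ , r)) = r

    via-trans : ∀ ps {u w v} → w ∈ ps → Via ps u w → Via ps w v → Via ps u v
    via-trans (p ∷ ps) (here refl) r s = inj₂ (via-to-head ps r , via-from-head ps s)
    via-trans (p ∷ ps) (there w∈) (inj₁ r)       (inj₁ s)       = inj₁ (via-trans ps w∈ r s)
    via-trans (p ∷ ps) (there w∈) (inj₁ r)       (inj₂ (s , t)) = inj₂ (via-trans ps w∈ r s , t)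
    via-trans (p ∷ ps) (there w∈) (inj₂ (q , r)) (inj₁ s)       = inj₂ (q , via-trans ps w∈ r s)
    via-trans (p ∷ ps) (there w∈) (inj₂ (q , _)) (inj₂ (_ , t)) = inj₂ (q , t)

    connected⇒via : ∀ {u v} → Connected u v → Via vertices u v
    connected⇒via ε       = via-base vertices (inj₁ refl)
    connected⇒via (_◅_ {j = w} a r) =
      via-trans vertices (∈-vertices w) (via-base vertices (inj₂ a)) (connected⇒via r)

  connected? : Decidable Connected
  connected? u v = map′ (via⇒connected vertices) connected⇒via (via? vertices u v)

  connectedDecSetoid : DecSetoid 0ℓ 0ℓ
  connectedDecSetoid = record
    { isDecEquivalence = record
      { isEquivalence = record { refl = ε ; sym = reverse adj-sym ; trans = _◅◅_ }
      ; _≟_           = connected?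
      }
    }

  -- One vertex from each connected component, by representatives-cover and
  -- representatives-separated.
  representatives : List Vertex
  representatives = deduplicate connected? vertices

  numComponents : ℕ
  numComponents = length representatives

  representatives-cover : ∀ v → Any (Connected v) representatives
  representatives-cover v =
    Any.deduplicate⁺ connected? (λ y~x v~x → v~x ◅◅ reverse adj-sym y~x)
      (Any.map (λ { refl → ε }) (∈-vertices v))

  representatives-separated : AllPairs (λ u v → ¬ Connected u v) representatives
  representatives-separated = UniqueDecSetoid.deduplicate-! connectedDecSetoid vertices

module _ (G : FiniteGraph) where
  open FiniteGraph G

  Coloring : ℕ → Set
  Coloring k = Vertex → Fin k

  monochromatic : ∀ {k} → Coloring k → FiniteGraph
  monochromatic c = record
    { Vertex     = Vertex
    ; order      = order
    ; enum       = enum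
    ; Adj        = λ u v → Adj u v × c u ≡ c v
    ; adj?       = λ u v → adj? u v ×-dec (c u Fin.≟ c v)
    ; adj-sym    = λ (a , e) → adj-sym a , sym e
    ; adj-irrefl = λ u≡v (a , _) → adj-irrefl u≡v a
    }

  numBlocks : ∀ {k} → Coloring k → ℕ
  numBlocks c = FiniteGraph.numComponents (monochromatic c)

  -- finToFun is a bijection from Fin (k ^ order) to the functions
  -- Fin order → Fin k, so this lists every coloring exactly once.
  coloring : ∀ k → Fin (k ^ order) → Coloring k
  coloring k ω = finToFun ω ∘ index

-- Independent uniform colors for the vertices amount to the uniform
-- distribution on the k ^ order colorings.
𝔼X : (k : ℕ) .{{_ : NonZero k}} → FiniteGraph → ℚ
𝔼X k G = (+ sum (tabulate (numBlocks G ∘ coloring G k))) / (k ^ order)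
  where
  open FiniteGraph G using (order)
  instance _ = m^n≢0 k order

-- Rooted trees in which every vertex has 0 or 2 children.
data BinaryTree : Set where
  leaf : BinaryTree
  node : BinaryTree → BinaryTree → BinaryTree

data TreeVertex : BinaryTree → Set where
  root  : ∀ {t} → TreeVertex t
  left  : ∀ {l r} → TreeVertex l → TreeVertex (node l r)
  right : ∀ {l r} → TreeVertex r → TreeVertex (node l r)

infix 4 _IsParentOf_

data _IsParentOf_ : ∀ {t} → Rel (TreeVertex t) 0ℓ where
  root-left  : ∀ {l r} → root {node l r} IsParentOf left root
  root-right : ∀ {l r} → root {node l r} IsParentOf right root
  in-left    : ∀ {l r} {u v : TreeVertex l} → u IsParentOf v → left {r = r} u IsParentOf left v
  in-right   : ∀ {l r} {u v : TreeVertex r} → u IsParentOf v → right {l} u IsParentOf right v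

height : ∀ {t} → TreeVertex t → ℕ
height root      = 0
height (left v)  = suc (height v)
height (right v) = suc (height v)

IsLeaf : ∀ {t} → TreeVertex t → Set
IsLeaf u = ∀ v → ¬ (u IsParentOf v)

LeavesAtHeight : ℕ → BinaryTree → Set
LeavesAtHeight n t = (v : TreeVertex t) → IsLeaf v → height v ≡ n

-- By B-leavesAtHeight and B-unique, the only tree satisfying LeavesAtHeight n.
B : ℕ → BinaryTree
B zero    = leaf
B (suc n) = node (B n) (B n)

left-isLeaf : ∀ {l r} {v : TreeVertex l} → IsLeaf v → IsLeaf (left {r = r} v)
left-isLeaf h _ (in-left p) = h _ p

right-isLeaf : ∀ {l r} {v : TreeVertex r} → IsLeaf v → IsLeaf (right {l} v)
right-isLeaf h _ (in-right p) = h _ p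

B-leavesAtHeight : ∀ n → LeavesAtHeight n (B n)
B-leavesAtHeight zero    root      _ = refl
B-leavesAtHeight (suc n) root      h = ⊥-elim (h _ root-left)
B-leavesAtHeight (suc n) (left v)  h = cong suc (B-leavesAtHeight n v (λ w p → h _ (in-left p)))
B-leavesAtHeight (suc n) (right v) h = cong suc (B-leavesAtHeight n v (λ w p → h _ (in-right p)))

B-unique : ∀ n t → LeavesAtHeight n t → t ≡ B n
B-unique zero    leaf       h = refl
B-unique (suc n) leaf       h with () ← h root (λ _ ())
B-unique zero    (node l r) h = ⊥-elim (no-leaf l (λ v v-leaf → left-absurd v v-leaf))
  where
  no-leaf : ∀ t → ¬ (∀ (v : TreeVertex t) → ¬ IsLeaf v)
  no-leaf leaf       none = none root (λ _ ())
  no-leaf (node l r) none = no-leaf l (λ v v-leaf → none (left v) (left-isLeaf v-leaf))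
  left-absurd : (v : TreeVertex l) → ¬ IsLeaf v
  left-absurd v v-leaf with () ← h (left v) (left-isLeaf v-leaf)
B-unique (suc n) (node l r) h = cong₂ node
  (B-unique n l (λ v v-leaf → suc-injective (h (left v) (left-isLeaf v-leaf))))
  (B-unique n r (λ v v-leaf → suc-injective (h (right v) (right-isLeaf v-leaf))))

size : BinaryTree → ℕ
size leaf       = 1
size (node l r) = suc (size l + size r)

toFin : ∀ t → TreeVertex t → Fin (size t)
toFin leaf       root      = zero
toFin (node l r) root      = zero
toFin (node l r) (left v)  = suc (join (size l) (size r) (inj₁ (toFin l v)))
toFin (node l r) (right v) = suc (join (size l) (size r) (inj₂ (toFin r v)))

mutual
  fromFin : ∀ t → Fin (size t) → TreeVertex t
  fromFin leaf       _       = root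
  fromFin (node l r) zero    = root
  fromFin (node l r) (suc i) = fromSplit l r (splitAt (size l) i)

  fromSplit : ∀ l r → Fin (size l) ⊎ Fin (size r) → TreeVertex (node l r)
  fromSplit l r (inj₁ i) = left (fromFin l i)
  fromSplit l r (inj₂ i) = right (fromFin r i)

fromFin-toFin : ∀ t v → fromFin t (toFin t v) ≡ v
fromFin-toFin leaf       root      = refl
fromFin-toFin (node l r) root      = refl
fromFin-toFin (node l r) (left v)  =
  trans (cong (fromSplit l r) (Fin.splitAt-join (size l) (size r) (inj₁ (toFin l v))))
        (cong left (fromFin-toFin l v))
fromFin-toFin (node l r) (right v) =
  trans (cong (fromSplit l r) (Fin.splitAt-join (size l) (size r) (inj₂ (toFin r v))))
        (cong right (fromFin-toFin r v))

mutual
  toFin-fromFin : ∀ t i → toFin t (fromFin t i) ≡ i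
  toFin-fromFin leaf       zero    = refl
  toFin-fromFin (node l r) zero    = refl
  toFin-fromFin (node l r) (suc i) =
    trans (toFin-fromSplit l r (splitAt (size l) i))
          (cong suc (Fin.join-splitAt (size l) (size r) i))

  toFin-fromSplit : ∀ l r s → toFin (node l r) (fromSplit l r s) ≡ suc (join (size l) (size r) s)
  toFin-fromSplit l r (inj₁ i) = cong (suc ∘ join (size l) (size r) ∘ inj₁) (toFin-fromFin l i)
  toFin-fromSplit l r (inj₂ i) = cong (suc ∘ join (size l) (size r) ∘ inj₂) (toFin-fromFin r i)

isParentOf? : ∀ {t} → Decidable (_IsParentOf_ {t})
isParentOf? root              root              = no λ ()
isParentOf? root              (left root)       = yes root-left
isParentOf? root              (left (left _))   = no λ ()
isParentOf? root              (left (right _))  = no λ ()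
isParentOf? root              (right root)      = yes root-right
isParentOf? root              (right (left _))  = no λ ()
isParentOf? root              (right (right _)) = no λ ()
isParentOf? (left u)          root              = no λ ()
isParentOf? (left u)          (left v)          = map′ in-left (λ { (in-left p) → p }) (isParentOf? u v)
isParentOf? (left u)          (right v)         = no λ ()
isParentOf? (right u)         root              = no λ ()
isParentOf? (right u)         (left v)          = no λ ()
isParentOf? (right u)         (right v)         = map′ in-right (λ { (in-right p) → p }) (isParentOf? u v)

isParentOf-irrefl : ∀ {t} (v : TreeVertex t) → ¬ (v IsParentOf v)
isParentOf-irrefl (left v)  (in-left p)  = isParentOf-irrefl v p
isParentOf-irrefl (right v) (in-right p) = isParentOf-irrefl v p

treeGraph : BinaryTree → FiniteGraph
treeGraph t = record
  { Vertex     = TreeVertex t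
  ; order      = size t
  ; enum       = mk↔ₛ′ (toFin t) (fromFin t) (toFin-fromFin t) (fromFin-toFin t)
  ; Adj        = SymClosure _IsParentOf_
  ; adj?       = λ u v → map′ (λ { (inj₁ p) → fwd p ; (inj₂ p) → bwd p })
                              (λ { (fwd p) → inj₁ p ; (bwd p) → inj₂ p })
                              (isParentOf? u v ⊎-dec isParentOf? v u)
  ; adj-sym    = symClosure-sym _IsParentOf_
  ; adj-irrefl = λ { refl (fwd p) → isParentOf-irrefl _ p
                   ; refl (bwd p) → isParentOf-irrefl _ p }
  }

{-# OPTIONS --safe #-}

-- Joining every vertex to its parent makes B n a forest with one edge per
-- non-root vertex, and every subgraph of a forest is again a forest. A forest
-- has as many components as vertices minus edges, so the number of blocks of a
-- coloring is the order minus the number of monochromatic edges. The ends of an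
-- edge receive equal colors with probability 1/k, whence by linearity of
-- expectation E[X] = |V| − |E| / k; for B n, |E| = |V| − 1 = 2 (2 ^ n − 1).

module Submission where

open import Defs
open import Data.Fin.Base using (Fin; zero; suc; _↑ˡ_; _↑ʳ_; splitAt; combine; finToFun)
import Data.Fin.Properties as Fin
open import Data.Integer.Base using (+_; _+_; _-_; _*_; 1ℤ)
import Data.Integer.Properties as ℤ
open import Data.Integer.Tactic.RingSolver using () renaming (solve-∀ to ℤ-solve-∀)
open import Data.List.Base using (List; []; _∷_; length; lookup; map; filter; tabulate; allFin)
open import Data.List.Membership.Propositional using (_∈_; lose)
open import Data.List.Membership.Propositional.Properties using (∈-filter⁺; ∈-filter⁻; ∈-lookup)
open import Data.List.Properties using (length-map; length-tabulate; map-tabulate; map-∘)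
import Data.List.Relation.Unary.All as All
open import Data.List.Relation.Unary.AllPairs using (AllPairs; _∷_)
open import Data.List.Relation.Unary.Any as Any using (Any)
open import Data.List.Relation.Unary.Any.Properties using (lookup-index)
import Data.List.Relation.Unary.Unique.Propositional.Properties as Unique
open import Data.Maybe.Base using (Maybe; just; nothing; fromMaybe; maybe′)
import Data.Nat.Base as ℕ
open import Data.Nat.Base using (ℕ; zero; suc; NonZero; _^_; _≤_)
open import Data.Nat.GeneralisedArithmetic using (iterate)
open import Data.Nat.ListAction using (sum)
import Data.Nat.Properties as ℕ
open import Algebra.Properties.Semiring.Sum ℕ.+-*-semiring
  using (sum-syntax; ∑-distrib-+; ∑-comm; sum-cong-≗; *-distribˡ-sum)
  renaming (sum to ∑)
open import Data.Nat.Tactic.RingSolver using (solve-∀)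
open import Data.Product.Base using (_×_; _,_; proj₁; proj₂; ∃)
open import Data.Rational.Base using (_/_)
import Data.Rational.Properties as ℚ
open import Data.Rational.Unnormalised.Base using (mkℚᵘ; *≡*)
open import Data.Sum.Base as Sum using (_⊎_; inj₁; inj₂)
open import Function.Base using (_∘_; id)
open import Function.Bundles using (Inverse)
open import Relation.Binary.Construct.Closure.ReflexiveTransitive using (ε; _◅_; _◅◅_; reverse)
open import Relation.Binary.Construct.Closure.Symmetric using (fwd; bwd)
open import Relation.Binary.Definitions using (Symmetric)
open import Relation.Binary.PropositionalEquality using (_≡_; _≢_; refl; sym; trans; cong; cong₂; subst; module ≡-Reasoning)
open import Relation.Nullary using (¬_; Dec; yes; no; contradiction)

-- Pigeonhole on lists and finite sums.

module _ {A : Set} {_~_ : A → A → Set} where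

  lookup-injective : Symmetric _~_ → ∀ {xs} → AllPairs (λ x y → ¬ (x ~ y)) xs →
    ∀ i j → lookup xs i ~ lookup xs j → i ≡ j
  lookup-injective ~-sym (_  ∷ _)   zero    zero    _ = refl
  lookup-injective ~-sym (px ∷ _)   zero    (suc j) e = contradiction e (All.lookup px (∈-lookup j))
  lookup-injective ~-sym (px ∷ _)   (suc i) zero    e = contradiction (~-sym e) (All.lookup px (∈-lookup i))
  lookup-injective ~-sym (_  ∷ pxs) (suc i) (suc j) e = cong suc (lookup-injective ~-sym pxs i j e)

  -- Pigeonhole: send each entry of `xs` to the position of a `Q`-related entry of `ys`. Two entries
  -- sent to the same position would be related by `_~_`, so this map is injective.
  separated⇒length≤ : Symmetric _~_ → ∀ {xs ys} (Q : A → A → Set) →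
    AllPairs (λ x y → ¬ (x ~ y)) xs →
    (∀ {x x′ y} → Q x y → Q x′ y → x ~ x′) →
    (∀ {x} → x ∈ xs → Any (Q x) ys) →
    length xs ≤ length ys
  separated⇒length≤ ~-sym {xs} {ys} Q sep Q⇒~ cover = Fin.injective⇒≤ {f = f} f-injective
    where
    witness : ∀ i → Any (Q (lookup xs i)) ys
    witness i = cover (∈-lookup i)

    f : Fin (length xs) → Fin (length ys)
    f i = Any.index (witness i)

    f-injective : ∀ {i j} → f i ≡ f j → i ≡ j
    f-injective {i} {j} fi≡fj = lookup-injective ~-sym sep i j
      (Q⇒~ (subst (λ m → Q (lookup xs i) (lookup ys m)) fi≡fj (lookup-index (witness i)))
           (lookup-index (witness j)))

∣_∣ᵐ : {A : Set} → Maybe A → ℕ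
∣ nothing ∣ᵐ = 0
∣ just _  ∣ᵐ = 1

nothing? : {A : Set} (m : Maybe A) → Dec (m ≡ nothing)
nothing? nothing  = yes refl
nothing? (just _) = no λ ()

length-filter-nothing? : {A B : Set} (f : A → Maybe B) (xs : List A) →
  length (filter (nothing? ∘ f) xs) ℕ.+ sum (map (∣_∣ᵐ ∘ f) xs) ≡ length xs
length-filter-nothing? f []       = refl
length-filter-nothing? f (x ∷ xs) with f x
... | nothing = cong suc (length-filter-nothing? f xs)
... | just _  = trans (ℕ.+-suc _ _) (cong suc (length-filter-nothing? f xs))

sum-tabulate : ∀ {n} (f : Fin n → ℕ) → sum (tabulate f) ≡ ∑ f
sum-tabulate {zero}  f = refl
sum-tabulate {suc n} f = cong (f zero ℕ.+_) (sum-tabulate (f ∘ suc))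

∑-const : ∀ n x → ∑[ i < n ] x ≡ n ℕ.* x
∑-const zero    x = refl
∑-const (suc n) x = cong (x ℕ.+_) (∑-const n x)

∑-↑ : ∀ m {n} (f : Fin (m ℕ.+ n) → ℕ) → ∑ f ≡ ∑ (λ i → f (i ↑ˡ n)) ℕ.+ ∑ (λ i → f (m ↑ʳ i))
∑-↑ zero    f = refl
∑-↑ (suc m) f = trans (cong (f zero ℕ.+_) (∑-↑ m (f ∘ suc))) (sym (ℕ.+-assoc (f zero) _ _))

-- Serves to split off the first letter of a word coded in `Fin (k ^ suc n)`.
∑-combine : ∀ m {n} (f : Fin (m ℕ.* n) → ℕ) → ∑ f ≡ ∑[ i < m ] ∑[ j < n ] f (combine i j)
∑-combine zero        f = refl
∑-combine (suc m) {n} f = trans (∑-↑ n f) (cong (∑ (λ j → f (j ↑ˡ m ℕ.* n)) ℕ.+_) (∑-combine m (λ i → f (n ↑ʳ i))))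

-- Forests and their components.

-- A forest structure: an edge joins a vertex to its parent, and depth rules out cycles.
record ParentFunction (G : FiniteGraph) : Set where
  open FiniteGraph G
  field
    parent       : Vertex → Maybe Vertex
    depth        : Vertex → ℕ
    parent-adj   : ∀ {v p} → parent v ≡ just p → Adj p v
    parent-depth : ∀ {v p} → parent v ≡ just p → depth v ≡ suc (depth p)
    adj-parent   : ∀ {u v} → Adj u v → parent v ≡ just u ⊎ parent u ≡ just v

  numEdges : ℕ
  numEdges = ∑[ i < order ] ∣ parent (Inverse.from enum i) ∣ᵐ

module _ {G : FiniteGraph} (F : ParentFunction G) where
  open FiniteGraph G
  open ParentFunction F

  private
    climb : Vertex → Vertex
    climb v = fromMaybe v (parent v)

    -- An invariant of components. `depth v` bounds the number of steps up from `v`, since depth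
    -- drops at each; surplus steps do no harm because `climb` fixes roots.
    top : Vertex → Vertex
    top v = iterate climb v (depth v)

    top-parent : ∀ {v p} → parent v ≡ just p → top v ≡ top p
    -- `iterate` applies `climb` before recursing, so the first of the `suc (depth p)` steps turns
    -- `v` into `p`.
    top-parent {v} {p} e rewrite parent-depth e | e = refl

    top-root : ∀ {v} → parent v ≡ nothing → top v ≡ v
    top-root {v} e = go (depth v)
      where
      go : ∀ n → iterate climb v n ≡ v
      go zero    = refl
      go (suc n) = trans (cong (λ m → iterate climb (fromMaybe v m) n) e) (go n)

    top-connected : ∀ {u v} → Connected u v → top u ≡ top v
    top-connected ε       = refl
    top-connected (a ◅ r) with adj-parent a
    ... | inj₁ e = trans (sym (top-parent e)) (top-connected r)
    ... | inj₂ e = trans (top-parent e) (top-connected r)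

    connected-to-root : ∀ v → ∃ λ r → Connected v r × parent r ≡ nothing
    connected-to-root v = go (depth v) refl
      where
      go : ∀ n {v} → depth v ≡ n → ∃ λ r → Connected v r × parent r ≡ nothing
      go n {v} d with parent v in e
      ... | nothing = v , ε , e
      go zero    d | just p = contradiction (trans (sym d) (parent-depth e)) λ ()
      go (suc n) d | just p with go n (ℕ.suc-injective (trans (sym (parent-depth e)) d))
      ... | r , p~r , r-root = r , adj-sym (parent-adj e) ◅ p~r , r-root

    root? : ∀ v → Dec (parent v ≡ nothing)
    root? v = nothing? (parent v)

    roots : List Vertex
    roots = filter root? vertices

  -- Each component contains a root, reached by climbing, and only one, because `top` is constant on
  -- components and fixes roots. Each half gives one inequality by pigeonhole.
  numComponents≡length-roots : numComponents ≡ length roots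
  numComponents≡length-roots = ℕ.≤-antisym
    (separated⇒length≤ (reverse adj-sym) Connected representatives-separated
      (λ x~y x′~y → x~y ◅◅ reverse adj-sym x′~y)
      (λ {v} _ → let r , v~r , r-root = connected-to-root v
                 in lose (∈-filter⁺ root? (∈-vertices r) r-root) v~r))
    -- Here the separating relation is equality. `Q` carries the root condition itself, since the
    -- uniqueness argument is not told that its entries come from `roots`.
    (separated⇒length≤ sym (λ u v → parent u ≡ nothing × Connected u v)
      (Unique.filter⁺ root? (Unique.map⁺ from-injective (Unique.allFin⁺ order)))
      (λ (u-root , u~w) (v-root , v~w) → trans (sym (top-root u-root))
        (trans (top-connected (u~w ◅◅ reverse adj-sym v~w)) (top-root v-root)))
      (λ {v} v∈ → Any.map (proj₂ (∈-filter⁻ root? {xs = vertices} v∈) ,_) (representatives-cover v)))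
    where
    from-injective : ∀ {i j} → Inverse.from enum i ≡ Inverse.from enum j → i ≡ j
    from-injective {i} {j} e = trans (sym (Inverse.strictlyInverseˡ enum i))
      (trans (cong index e) (Inverse.strictlyInverseˡ enum j))

  -- The vertices split into roots, one per component, and non-roots, one per edge.
  numComponents+numEdges≡order : numComponents ℕ.+ numEdges ≡ order
  numComponents+numEdges≡order = begin
    numComponents ℕ.+ numEdges
      ≡⟨ cong₂ ℕ._+_ numComponents≡length-roots (sym sum-vertices) ⟩
    length roots ℕ.+ sum (map (∣_∣ᵐ ∘ parent) vertices)
      ≡⟨ length-filter-nothing? parent vertices ⟩
    length vertices
      ≡⟨ trans (length-map _ (allFin order)) (length-tabulate {n = order} id) ⟩
    order ∎
    where
    open ≡-Reasoning
    sum-vertices : sum (map (∣_∣ᵐ ∘ parent) vertices) ≡ numEdges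
    sum-vertices = trans
      (cong sum (trans (sym (map-∘ (allFin order))) (map-tabulate {n = order} id _)))
      (sum-tabulate {order} _)

-- The forest of monochromatic edges.

keepEqual : ∀ {k} {V : Set} (c : V → Fin k) (v : V) → Maybe V → Maybe V
keepEqual c v nothing  = nothing
keepEqual c v (just p) with c p Fin.≟ c v
... | yes _ = just p
... | no  _ = nothing

keepEqual-just⁻ : ∀ {k} {V : Set} {c : V → Fin k} {v : V} m {p} →
  keepEqual c v m ≡ just p → m ≡ just p × c p ≡ c v
keepEqual-just⁻ {c = c} {v} (just p) e with c p Fin.≟ c v
keepEqual-just⁻ (just p) refl | yes cp≡cv = refl , cp≡cv

keepEqual-just⁺ : ∀ {k} {V : Set} {c : V → Fin k} {v : V} {m p} →
  m ≡ just p → c p ≡ c v → keepEqual c v m ≡ just p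
keepEqual-just⁺ {c = c} {v} {p = p} refl cp≡cv with c p Fin.≟ c v
... | yes _     = refl
... | no  cp≢cv = contradiction cp≡cv cp≢cv

monochromaticParent : ∀ {G k} → ParentFunction G → (c : Coloring G k) → ParentFunction (monochromatic G c)
monochromaticParent F c = record
  { parent       = λ v → keepEqual c v (parent v)
  -- Depth is constrained only along parent edges, so the old one still serves; a vertex cut from
  -- its parent becomes a root of positive depth.
  ; depth        = depth
  ; parent-adj   = λ e → let e′ , cp≡cv = keepEqual-just⁻ _ e in parent-adj e′ , cp≡cv
  ; parent-depth = λ e → parent-depth (proj₁ (keepEqual-just⁻ _ e))
  ; adj-parent   = λ (a , cu≡cv) →
      Sum.map (λ e → keepEqual-just⁺ e cu≡cv) (λ e → keepEqual-just⁺ e (sym cu≡cv)) (adj-parent a)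
  }
  where open ParentFunction F

-- How often two positions of a word agree.

[_≐_] : ∀ {k} → Fin k → Fin k → ℕ
[ a ≐ b ] with a Fin.≟ b
... | yes _ = 1
... | no  _ = 0

[suc≐suc] : ∀ {k} (a b : Fin k) → [ suc a ≐ suc b ] ≡ [ a ≐ b ]
[suc≐suc] a b with a Fin.≟ b
... | yes _ = refl
... | no  _ = refl

≐-comm : ∀ {k} (a b : Fin k) → [ a ≐ b ] ≡ [ b ≐ a ]
≐-comm a b with a Fin.≟ b | b Fin.≟ a
... | yes _    | yes _    = refl
... | no  _    | no  _    = refl
... | yes refl | no  b≢a  = contradiction refl b≢a
... | no  a≢b  | yes refl = contradiction refl a≢b

∑-≐ : ∀ {k} (b : Fin k) → ∑[ a < k ] [ a ≐ b ] ≡ 1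
∑-≐ {suc k} zero    = cong suc (trans (∑-const k 0) (ℕ.*-zeroʳ k))
∑-≐ {suc k} (suc b) = trans (sum-cong-≗ (λ a → [suc≐suc] a b)) (∑-≐ b)

-- The arguments k and n of finToFun cannot be recovered from Fin (k ^ n).
word : ∀ k n → Fin (k ^ n) → Fin n → Fin k
word k n = finToFun

module _ {k n : ℕ} where

  word-combine-zero : ∀ a ρ → word k (suc n) (combine a ρ) zero ≡ a
  word-combine-zero a ρ = cong proj₁ (Fin.remQuot-combine a ρ)

  word-combine-suc : ∀ a ρ j → word k (suc n) (combine a ρ) (suc j) ≡ word k n ρ j
  word-combine-suc a ρ j = cong (λ rq → word k n (proj₂ rq) j) (Fin.remQuot-combine {k} a ρ)

-- Once the later letters are fixed, exactly one of the `k` choices for the first letter agrees with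
-- the given one.
∑-word-≐-zero : ∀ k {n} (j : Fin n) →
  k ℕ.* ∑[ ω < k ^ suc n ] [ word k (suc n) ω zero ≐ word k (suc n) ω (suc j) ] ≡ k ^ suc n
∑-word-≐-zero k {n} j = cong (k ℕ.*_) (begin
  ∑[ ω < k ^ suc n ] [ w ω zero ≐ w ω (suc j) ]
    ≡⟨ ∑-combine k _ ⟩
  ∑[ a < k ] ∑[ ρ < k ^ n ] [ w (combine a ρ) zero ≐ w (combine a ρ) (suc j) ]
    ≡⟨ sum-cong-≗ {k} (λ a → sum-cong-≗ {k ^ n} (λ ρ →
         cong₂ [_≐_] (word-combine-zero {k} {n} a ρ) (word-combine-suc a ρ j))) ⟩
  ∑[ a < k ] ∑[ ρ < k ^ n ] [ a ≐ word k n ρ j ]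
    ≡⟨ ∑-comm {k} {k ^ n} _ ⟩
  ∑[ ρ < k ^ n ] ∑[ a < k ] [ a ≐ word k n ρ j ]
    ≡⟨ sum-cong-≗ {k ^ n} (λ ρ → ∑-≐ (word k n ρ j)) ⟩
  ∑[ ρ < k ^ n ] 1
    ≡⟨ trans (∑-const (k ^ n) 1) (ℕ.*-identityʳ (k ^ n)) ⟩
  k ^ n ∎)
  where
  open ≡-Reasoning
  w = word k (suc n)

-- Two distinct positions agree with probability 1/k; the factor `k` on the left avoids both
-- division and the exponent n - 1. If neither position is the first, the first letter is free and
-- contributes a factor `k` to the induction.
∑-word-≐ : ∀ k {n} (i j : Fin n) → i ≢ j →
  k ℕ.* ∑[ ω < k ^ n ] [ word k n ω i ≐ word k n ω j ] ≡ k ^ n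
∑-word-≐ k         zero    zero    i≢j = contradiction refl i≢j
∑-word-≐ k         zero    (suc j) i≢j = ∑-word-≐-zero k j
∑-word-≐ k {suc n} (suc i) zero    i≢j = trans
  (cong (k ℕ.*_) (sum-cong-≗ {k ^ suc n} (λ ω →
    ≐-comm (word k (suc n) ω (suc i)) (word k (suc n) ω zero))))
  (∑-word-≐-zero k i)
∑-word-≐ k {suc n} (suc i) (suc j) i≢j = cong (k ℕ.*_) (begin
  ∑[ ω < k ^ suc n ] [ w ω (suc i) ≐ w ω (suc j) ]
    ≡⟨ ∑-combine k _ ⟩
  ∑[ a < k ] ∑[ ρ < k ^ n ] [ w (combine a ρ) (suc i) ≐ w (combine a ρ) (suc j) ]
    ≡⟨ sum-cong-≗ {k} (λ a → sum-cong-≗ {k ^ n} (λ ρ →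
         cong₂ [_≐_] (word-combine-suc a ρ i) (word-combine-suc a ρ j))) ⟩
  ∑[ a < k ] ∑[ ρ < k ^ n ] [ word k n ρ i ≐ word k n ρ j ]
    ≡⟨ ∑-const k _ ⟩
  k ℕ.* ∑[ ρ < k ^ n ] [ word k n ρ i ≐ word k n ρ j ]
    ≡⟨ ∑-word-≐ k i j (i≢j ∘ cong suc) ⟩
  k ^ n ∎)
  where
  open ≡-Reasoning
  w = word k (suc n)

-- Linearity of expectation over the edges.

module _ {G : FiniteGraph} (F : ParentFunction G) (k : ℕ) where
  open FiniteGraph G
  open ParentFunction F
  open ≡-Reasoning

  private
    N = k ^ order

    monochromaticEdge : Fin N → Vertex → ℕ
    monochromaticEdge ω v = ∣ keepEqual (coloring G k ω) v (parent v) ∣ᵐ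

  -- A root gives 0 on both sides. Otherwise irreflexivity of adjacency makes the positions of `v`
  -- and its parent distinct, so `∑-word-≐` applies.
  ∑-monochromaticEdge : ∀ v → k ℕ.* ∑[ ω < N ] monochromaticEdge ω v ≡ N ℕ.* ∣ parent v ∣ᵐ
  ∑-monochromaticEdge v with parent v in e
  ... | nothing = begin
    k ℕ.* ∑[ ω < N ] 0  ≡⟨ cong (k ℕ.*_) (trans (∑-const N 0) (ℕ.*-zeroʳ N)) ⟩
    k ℕ.* 0             ≡⟨ ℕ.*-zeroʳ k ⟩
    0                   ≡⟨ ℕ.*-zeroʳ N ⟨
    N ℕ.* 0             ∎
  ... | just p = begin
    k ℕ.* ∑[ ω < N ] ∣ keepEqual (coloring G k ω) v (just p) ∣ᵐ
      ≡⟨ cong (k ℕ.*_) (sum-cong-≗ {N} (λ ω → indicator (coloring G k ω))) ⟩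
    k ℕ.* ∑[ ω < N ] [ word k order ω (index p) ≐ word k order ω (index v) ]
      ≡⟨ ∑-word-≐ k (index p) (index v) index-p≢index-v ⟩
    N
      ≡⟨ ℕ.*-identityʳ N ⟨
    N ℕ.* 1 ∎
    where
    indicator : (c : Coloring G k) → ∣ keepEqual c v (just p) ∣ᵐ ≡ [ c p ≐ c v ]
    indicator c with c p Fin.≟ c v
    ... | yes _ = refl
    ... | no  _ = refl

    index-p≢index-v : index p ≢ index v
    index-p≢index-v q = adj-irrefl (trans (sym (Inverse.strictlyInverseʳ enum p))
      (trans (cong (Inverse.from enum) q) (Inverse.strictlyInverseʳ enum v))) (parent-adj e)

  -- |V| = E[X] + |E| / k, multiplied by k · k ^ |V|.
  ∑-numBlocks : k ℕ.* ∑ (numBlocks G ∘ coloring G k) ℕ.+ N ℕ.* numEdges ≡ k ℕ.* (N ℕ.* order)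
  ∑-numBlocks = begin
    k ℕ.* ∑ X ℕ.+ N ℕ.* numEdges
      ≡⟨ cong (k ℕ.* ∑ X ℕ.+_) (sym ∑-edges) ⟩
    k ℕ.* ∑ X ℕ.+ k ℕ.* ∑[ ω < N ] ∑[ i < order ] monochromaticEdge ω (from i)
      ≡⟨ ℕ.*-distribˡ-+ k (∑ X) _ ⟨
    k ℕ.* (∑ X ℕ.+ ∑[ ω < N ] ∑[ i < order ] monochromaticEdge ω (from i))
      ≡⟨ cong (k ℕ.*_) (sym (∑-distrib-+ X _)) ⟩
    k ℕ.* ∑[ ω < N ] (X ω ℕ.+ ∑[ i < order ] monochromaticEdge ω (from i))
      -- For each single coloring, the monochromatic subgraph is a forest: blocks plus surviving
      -- edges give the order.
      ≡⟨ cong (k ℕ.*_) (sum-cong-≗ {N} (λ ω →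
           numComponents+numEdges≡order (monochromaticParent F (coloring G k ω)))) ⟩
    k ℕ.* ∑[ ω < N ] order
      ≡⟨ cong (k ℕ.*_) (∑-const N order) ⟩
    k ℕ.* (N ℕ.* order) ∎
    where
    from = Inverse.from enum

    X : Fin N → ℕ
    X = numBlocks G ∘ coloring G k

    ∑-edges : k ℕ.* ∑[ ω < N ] ∑[ i < order ] monochromaticEdge ω (from i) ≡ N ℕ.* numEdges
    ∑-edges = begin
      k ℕ.* ∑[ ω < N ] ∑[ i < order ] monochromaticEdge ω (from i)
        -- Exchanging the sums lets each edge be averaged over the colorings on its own.
        ≡⟨ cong (k ℕ.*_) (∑-comm {N} {order} _) ⟩
      k ℕ.* ∑[ i < order ] ∑[ ω < N ] monochromaticEdge ω (from i)
        ≡⟨ *-distribˡ-sum {order} k _ ⟩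
      ∑[ i < order ] (k ℕ.* ∑[ ω < N ] monochromaticEdge ω (from i))
        ≡⟨ sum-cong-≗ {order} (λ i → ∑-monochromaticEdge (from i)) ⟩
      ∑[ i < order ] (N ℕ.* ∣ parent (from i) ∣ᵐ)
        ≡⟨ *-distribˡ-sum {order} N _ ⟨
      N ℕ.* numEdges ∎

-- Parents and edge counts in binary trees.

treeParent : ∀ {t} → TreeVertex t → Maybe (TreeVertex t)
treeParent root      = nothing
-- The root of a subtree is parentless there; the default `root` hangs it below the root of the
-- whole tree.
treeParent (left v)  = just (maybe′ left root (treeParent v))
treeParent (right v) = just (maybe′ right root (treeParent v))

treeParent⇒isParentOf : ∀ {t} (v : TreeVertex t) {p} → treeParent v ≡ just p → p IsParentOf v
treeParent⇒isParentOf (left root)        refl = root-left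
treeParent⇒isParentOf (left (left v))    refl = in-left (treeParent⇒isParentOf (left v) refl)
treeParent⇒isParentOf (left (right v))   refl = in-left (treeParent⇒isParentOf (right v) refl)
treeParent⇒isParentOf (right root)       refl = root-right
treeParent⇒isParentOf (right (left v))   refl = in-right (treeParent⇒isParentOf (left v) refl)
treeParent⇒isParentOf (right (right v))  refl = in-right (treeParent⇒isParentOf (right v) refl)

isParentOf⇒treeParent : ∀ {t} {p v : TreeVertex t} → p IsParentOf v → treeParent v ≡ just p
isParentOf⇒treeParent root-left    = refl
isParentOf⇒treeParent root-right   = refl
isParentOf⇒treeParent (in-left q)  = cong (just ∘ maybe′ left root) (isParentOf⇒treeParent q)
isParentOf⇒treeParent (in-right q) = cong (just ∘ maybe′ right root) (isParentOf⇒treeParent q)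

isParentOf-height : ∀ {t} {p v : TreeVertex t} → p IsParentOf v → height v ≡ suc (height p)
isParentOf-height root-left    = refl
isParentOf-height root-right   = refl
isParentOf-height (in-left q)  = cong suc (isParentOf-height q)
isParentOf-height (in-right q) = cong suc (isParentOf-height q)

treeParentFunction : ∀ t → ParentFunction (treeGraph t)
treeParentFunction t = record
  { parent       = treeParent
  ; depth        = height
  ; parent-adj   = λ {v} e → fwd (treeParent⇒isParentOf v e)
  ; parent-depth = λ {v} e → isParentOf-height (treeParent⇒isParentOf v e)
  ; adj-parent   = λ { (fwd q) → inj₁ (isParentOf⇒treeParent q)
                     ; (bwd q) → inj₂ (isParentOf⇒treeParent q) }
  }

-- Index `zero` enumerates the root and contributes 0; every other index lands in one of the two
-- subtrees, where each vertex has a parent in the whole tree.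
size≡1+numEdges : ∀ t → size t ≡ suc (ParentFunction.numEdges (treeParentFunction t))
size≡1+numEdges leaf       = refl
size≡1+numEdges (node l r) = cong suc (sym (trans
  (sum-cong-≗ {m} (λ i → nonRoot (splitAt (size l) i)))
  (trans (∑-const m 1) (ℕ.*-identityʳ m))))
  where
  m = size l ℕ.+ size r

  nonRoot : ∀ s → ∣ treeParent (fromSplit l r s) ∣ᵐ ≡ 1
  nonRoot (inj₁ _) = refl
  nonRoot (inj₂ _) = refl

1+size-B : ∀ n → suc (size (B n)) ≡ 2 ℕ.* 2 ^ n
1+size-B zero    = refl
1+size-B (suc n) = begin
  suc (suc (size (B n) ℕ.+ size (B n)))  ≡⟨ lemma (size (B n)) ⟩
  2 ℕ.* suc (size (B n))                 ≡⟨ cong (2 ℕ.*_) (1+size-B n) ⟩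
  2 ℕ.* 2 ^ suc n                        ∎
  where
  open ≡-Reasoning
  lemma : ∀ x → suc (suc (x ℕ.+ x)) ≡ 2 ℕ.* suc x
  lemma = solve-∀

-- From counts to the rational formula.

/-cross : ∀ p q m n .{{_ : NonZero m}} .{{_ : NonZero n}} → p * + n ≡ q * + m → p / m ≡ q / n
-- `mkℚᵘ` stores the denominator minus one, hence the match on `suc`.
/-cross p q (suc m) (suc n) e = ℚ.fromℚᵘ-cong {mkℚᵘ p m} {mkℚᵘ q n} (*≡* e)

-- Here `s` stands for the total number of blocks, `K` for the number of colorings, `e` for the
-- number of edges and `P` for 2 ^ n.
clear-denominators : ∀ s k K e P → k * s + K * e ≡ k * (K * (1ℤ + e)) → + 2 + e ≡ + 2 * P →
  s * k ≡ (k + + 2 * (k - 1ℤ) * (P - 1ℤ)) * K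
clear-denominators s k K e P total edges = begin
  s * k                                                ≡⟨ isolate s k K e ⟩
  (k * s + K * e) - K * e                              ≡⟨ cong (_- K * e) total ⟩
  -- The next form writes `e` as `(+ 2 + e) - + 2` so that the hypothesis `edges` can be
  -- substituted.
  k * (K * (1ℤ + e)) - K * e                           ≡⟨ collect k K e ⟩
  (k + (k - 1ℤ) * ((+ 2 + e) - + 2)) * K               ≡⟨ cong (λ x → (k + (k - 1ℤ) * (x - + 2)) * K) edges ⟩
  (k + (k - 1ℤ) * (+ 2 * P - + 2)) * K                 ≡⟨ factor k K P ⟩
  (k + + 2 * (k - 1ℤ) * (P - 1ℤ)) * K                  ∎
  where
  open ≡-Reasoning
  isolate : ∀ s k K e → s * k ≡ (k * s + K * e) - K * e
  isolate = ℤ-solve-∀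
  collect : ∀ k K e → k * (K * (1ℤ + e)) - K * e ≡ (k + (k - 1ℤ) * ((+ 2 + e) - + 2)) * K
  collect = ℤ-solve-∀
  factor : ∀ k K P → (k + (k - 1ℤ) * (+ 2 * P - + 2)) * K ≡ (k + + 2 * (k - 1ℤ) * (P - 1ℤ)) * K
  factor = ℤ-solve-∀

corollary2p2 : (k : ℕ) .{{_ : NonZero k}} (n : ℕ) →
    𝔼X k (treeGraph (B n)) ≡ (+ k + + 2 * (+ k - 1ℤ) * (+ (2 ^ n) - 1ℤ)) / k
corollary2p2 k n = /-cross (+ S) (+ k + + 2 * (+ k - 1ℤ) * (+ (2 ^ n) - 1ℤ)) K k {{ℕ.m^n≢0 k (size (B n))}}
  (clear-denominators (+ S) (+ k) (+ K) (+ E) (+ (2 ^ n)) total edges)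
  where
  open ≡-Reasoning
  G = treeGraph (B n)
  F = treeParentFunction (B n)
  K = k ^ size (B n)
  E = ParentFunction.numEdges F
  S = sum (tabulate (numBlocks G ∘ coloring G k))

  total : + k * + S + + K * + E ≡ + k * (+ K * (1ℤ + + E))
  total = begin
    + k * + S + + K * + E          ≡⟨ cong₂ _+_ (ℤ.pos-* k S) (ℤ.pos-* K E) ⟨
    + (k ℕ.* S ℕ.+ K ℕ.* E)        ≡⟨ cong (λ x → + (k ℕ.* x ℕ.+ K ℕ.* E)) (sum-tabulate {K} _) ⟩
    + (k ℕ.* ∑ {K} (numBlocks G ∘ coloring G k) ℕ.+ K ℕ.* E)
                                   ≡⟨ cong +_ (∑-numBlocks F k) ⟩
    + (k ℕ.* (K ℕ.* size (B n)))   ≡⟨ cong (λ x → + (k ℕ.* (K ℕ.* x))) (size≡1+numEdges (B n)) ⟩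
    + (k ℕ.* (K ℕ.* suc E))        ≡⟨ ℤ.pos-* k (K ℕ.* suc E) ⟩
    + k * + (K ℕ.* suc E)          ≡⟨ cong (+ k *_) (ℤ.pos-* K (suc E)) ⟩
    + k * (+ K * (1ℤ + + E))       ∎

  edges : + 2 + + E ≡ + 2 * + (2 ^ n)
  edges = begin
    + suc (suc E)         ≡⟨ cong (+_ ∘ suc) (size≡1+numEdges (B n)) ⟨
    + suc (size (B n))    ≡⟨ cong +_ (1+size-B n) ⟩
    + (2 ℕ.* 2 ^ n)       ≡⟨ ℤ.pos-* 2 (2 ^ n) ⟩
    + 2 * + (2 ^ n)       ∎
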